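{- Let $G = P_{n_1}\square P_{n_2}\square\cdots\square P_{n_k}$ be a Cartesian product of $k$ paths, where $n_i \neq n_j$ for $i\neq j$ and $n_i\geq 3$ for all $i\in\{1,\dots,k\}$. Then $\rho'(G)=\rho(G)=1$.
   Context: $P_n$ is the path on $n$ vertices and $\square$ is the Cartesian product of graphs. A vertex (or edge) coloring of a graph is distinguishing if no automorphism other than the identity preserves it. $D(G)$ (resp. $D'(G)$) is the least number of colors in a distinguishing vertex (resp. edge) coloring of $G$. When $D(G)=2$, the cost of distinguishing $\rho(G)$ is the minimum number of vertices in the smaller color class over all distinguishing vertex colorings of $G$ with two colors. When $D'(G)=2$, the cost of edge-distinguishing $\rho'(G)$ is the minimum number of edges in the smaller color class over all distinguishing edge colorings of $G$ with two colors. -}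

module Defs where

open import Data.Fin using (Fin; zero; suc; toℕ)
open import Data.Nat using (ℕ; suc; _≤_; _⊓_)
open import Data.Nat.Properties using (1+n≢n)
open import Data.Product using (Σ; ∃; _×_; _,_; proj₁)
open import Data.Sum using (_⊎_; inj₁; inj₂; swap; [_,_]′)
open import Data.Vec using (Vec; map; foldr₁)
open import Level using (0ℓ)
open import Function using (Inverse; Func; _↔_; _⇔_; Equivalence)
open import Relation.Binary using (Rel; Setoid; Symmetric; Irreflexive)
import Relation.Binary.Construct.On as On
open import Relation.Binary.PropositionalEquality
  using (_≡_; refl; sym; trans; cong; setoid)

record Graph : Set₁ where
  infix 4 _~_
  field
    Vertex   : Set
    _~_      : Vertex → Vertex → Set
    ~-sym    : Symmetric _~_
    ~-irrefl : Irreflexive _≡_ _~_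

open Graph public using (Vertex)

path : ℕ → Graph
path n = record
  { Vertex   = Fin n
  ; _~_      = λ i j → (suc (toℕ i) ≡ toℕ j) ⊎ (suc (toℕ j) ≡ toℕ i)
  ; ~-sym    = swap
  ; ~-irrefl = λ { refl → [ 1+n≢n , 1+n≢n ]′ }
  }

infixr 7 _□_

_□_ : Graph → Graph → Graph
G □ H = record
  { Vertex   = G.Vertex × H.Vertex
  ; _~_      = λ (g , h) (g′ , h′) → ((g ≡ g′) × (h H.~ h′)) ⊎ ((g G.~ g′) × (h ≡ h′))
  ; ~-sym    = λ { (inj₁ (p , q)) → inj₁ (sym p , H.~-sym q)
                 ; (inj₂ (p , q)) → inj₂ (G.~-sym p , sym q) }
  ; ~-irrefl = λ { refl (inj₁ (_ , q)) → H.~-irrefl refl q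
                 ; refl (inj₂ (p , _)) → G.~-irrefl refl p }
  }
  where
  module G = Graph G
  module H = Graph H

pathProduct : ∀ {k} → Vec ℕ (suc k) → Graph
pathProduct ns = foldr₁ _□_ (map path ns)

record Automorphism (G : Graph) : Set where
  open Graph G using (_~_)
  field
    bijection : Vertex G ↔ Vertex G

  to : Vertex G → Vertex G
  to = Inverse.to bijection

  field
    preserves-~ : ∀ {u v} → u ~ v ⇔ to u ~ to v

IsIdentity : ∀ {G} → Automorphism G → Set
IsIdentity {G} φ = ∀ (v : Vertex G) → Automorphism.to φ v ≡ v

-- The objects being colored (vertices or edges), with the action of the
-- automorphisms of G on them.
record Colorable (G : Graph) : Set₁ where
  field
    objects : Setoid 0ℓ 0ℓ
    act     : Automorphism G → Setoid.Carrier objects → Setoid.Carrier objects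

vertices : ∀ G → Colorable G
vertices G = record { objects = setoid (Vertex G) ; act = Automorphism.to }

-- An edge is an unordered pair of adjacent vertices: it is represented by an
-- ordered pair, and the setoid equality identifies the two orientations and
-- ignores the adjacency proof.
edgeSetoid : Graph → Setoid 0ℓ 0ℓ
edgeSetoid G = record
  { Carrier       = Σ (Vertex G) λ u → Σ (Vertex G) λ v → u ~ v
  ; _≈_           = λ (u , v , _) (u′ , v′ , _) →
                      ((u ≡ u′) × (v ≡ v′)) ⊎ ((u ≡ v′) × (v ≡ u′))
  ; isEquivalence = record
    { refl  = inj₁ (refl , refl)
    ; sym   = λ { (inj₁ (p , q)) → inj₁ (sym p , sym q)
                ; (inj₂ (p , q)) → inj₂ (sym q , sym p) }
    ; trans = λ { (inj₁ (p , q)) (inj₁ (r , s)) → inj₁ (trans p r , trans q s)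
                ; (inj₁ (p , q)) (inj₂ (r , s)) → inj₂ (trans p r , trans q s)
                ; (inj₂ (p , q)) (inj₁ (r , s)) → inj₂ (trans p s , trans q r)
                ; (inj₂ (p , q)) (inj₂ (r , s)) → inj₁ (trans p s , trans q r) }
    }
  }
  where open Graph G using (_~_)

edges : ∀ G → Colorable G
edges G = record
  { objects = edgeSetoid G
  ; act     = λ φ (u , v , u~v) → let open Automorphism φ in
                to u , to v , Equivalence.to preserves-~ u~v
  }

HasSize : Setoid 0ℓ 0ℓ → ℕ → Set
HasSize S m = Inverse S (setoid (Fin m))

IsLeast : (ℕ → Set) → ℕ → Set
IsLeast P m = P m × (∀ n → P n → m ≤ n)

module _ {G : Graph} (X : Colorable G) where
  open Colorable X

  -- Colors need not all be used.
  Coloring : ℕ → Set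
  Coloring d = Func objects (setoid (Fin d))

  colorClass : ∀ {d} → Coloring d → Fin d → Setoid 0ℓ 0ℓ
  colorClass c i = On.setoid {B = ∃ λ x → Func.to c x ≡ i} objects proj₁

  IsDistinguishing : ∀ {d} → Coloring d → Set
  IsDistinguishing c =
    ∀ φ → (∀ x → Func.to c (act φ x) ≡ Func.to c x) → IsIdentity φ

  IsDistinguishingNumber : ℕ → Set
  IsDistinguishingNumber = IsLeast λ d → ∃ λ (c : Coloring d) → IsDistinguishing c

  SmallerClassHasSize : Coloring 2 → ℕ → Set
  SmallerClassHasSize c m = ∃ λ a → ∃ λ b →
    HasSize (colorClass c zero) a × HasSize (colorClass c (suc zero)) b × m ≡ a ⊓ b

  -- The cost is only defined when the distinguishing number is 2, so having
  -- a given cost includes that condition.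
  IsCost : ℕ → Set
  IsCost m = IsDistinguishingNumber 2 ×
    IsLeast (λ n → ∃ λ (c : Coloring 2) → IsDistinguishing c × SmallerClassHasSize c n) m

_HasDistinguishingCost_ : Graph → ℕ → Set
G HasDistinguishingCost m = IsCost (vertices G) m

_HasEdgeDistinguishingCost_ : Graph → ℕ → Set
G HasEdgeDistinguishingCost m = IsCost (edges G) m

{-# OPTIONS --safe #-}
-- Coloring a single corner of the box is distinguishing.  An automorphism φ
-- fixing a corner o preserves the distance to o (the sum of the coordinates),
-- hence the relation "v is u plus a unit vector".  It therefore maps the axis i
-- from o into some axis j, so nᵢ ≤ nⱼ; applying this to φ⁻¹ gives nᵢ = nⱼ, hence
-- i = j and φ fixes the axes.  Any other vertex is determined by two of its
-- neighbours closer to o, so φ is the identity by induction on the distance.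
-- For edges, color an edge oe at the corner: its ends cannot be swapped because
-- e has more neighbours than o.  Reflecting a factor excludes constant colorings.
module Submission where

open import Defs
open import Data.Nat using (ℕ; suc; _≤_)
open import Data.Vec using (Vec; lookup)
open import Data.Product using (_×_)
open import Relation.Binary.PropositionalEquality using (_≢_)
open import Data.Fin using (Fin; zero; suc; toℕ; fromℕ<; opposite)
open import Data.Fin.Properties as Fin
  using (toℕ-injective; toℕ<n; toℕ-fromℕ<; opposite-prop; opposite-involutive; any?; pigeonhole)
open import Data.List as List using (List; []; _∷_; [_]; concatMap; deduplicate; allFin; cartesianProduct)
open import Data.List.Membership.Propositional.Properties using (∈-lookup; ∈-allFin; ∈-cartesianProduct⁺)
open import Data.List.Relation.Unary.All as All using (_∷_)
open import Data.List.Relation.Unary.Any as Any using (Any; here; index)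
open import Data.List.Relation.Unary.Any.Properties using (lookup-index; concatMap⁺)
open import Data.List.Relation.Unary.AllPairs using (_∷_)
open import Data.List.Relation.Unary.Enumerates.Setoid using (IsEnumeration)
open import Data.List.Relation.Unary.Enumerates.Setoid.Properties using (deduplicate⁺)
open import Data.List.Relation.Unary.Unique.DecSetoid.Properties using (deduplicate-!)
open import Data.List.Relation.Unary.Unique.Setoid using (Unique)
open import Data.Nat using (zero; _+_; _∸_; _<_; _⊓_; z≤n; s≤s; ≢-nonZero)
open import Data.Nat.Properties
open import Data.Product using (∃; ∃₂; _,_; proj₁; proj₂)
open import Data.Product.Properties using (≡-dec)
open import Data.Sum as Sum using (_⊎_; inj₁; inj₂)
open import Data.Vec using ([]; _∷_)
open import Data.Vec.Functional using (updateAt)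
open import Data.Vec.Functional.Properties using (updateAt-updates; updateAt-minimal)
open import Function using (Func; Inverse; Equivalence; _∘_; const; mk⇔; mk↔ₛ′)
open import Function.Properties.Inverse using (↔-sym)
open import Level using (0ℓ)
open import Relation.Binary using (Setoid; DecSetoid; Decidable; DecidableEquality)
open import Relation.Binary.PropositionalEquality
  using (_≡_; refl; sym; trans; cong; cong₂; subst; subst₂; setoid)
open import Relation.Nullary using (¬_; Dec; yes; no; contradiction)
open import Relation.Nullary.Decidable using (_×-dec_; _⊎-dec_; ¬?; decidable-stable)

-- Sizes of finite setoids from enumerations.

lookup-injective : ∀ (S : Setoid 0ℓ 0ℓ) {xs} → Unique S xs → ∀ i j →
  Setoid._≈_ S (List.lookup xs i) (List.lookup xs j) → i ≡ j
lookup-injective S (_ ∷ _)    zero    zero    _   = refl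
lookup-injective S (x∉ ∷ _)   zero    (suc j) x≈y = contradiction x≈y (All.lookup x∉ (∈-lookup j))
lookup-injective S (x∉ ∷ _)   (suc i) zero    y≈x =
  contradiction (Setoid.sym S y≈x) (All.lookup x∉ (∈-lookup i))
lookup-injective S (_ ∷ uniq) (suc i) (suc j) x≈y = cong suc (lookup-injective S uniq i j x≈y)

-- Once duplicates up to `≈` are removed, each element has exactly one position in the list, and
-- that position is the bijection. The size is produced without being computed, which suffices for
-- the larger color class.
enumeration⇒hasSize : ∀ (S : Setoid 0ℓ 0ℓ) → Decidable (Setoid._≈_ S) →
  ∃ (IsEnumeration S) → ∃ (HasSize S)
enumeration⇒hasSize S _≈?_ (xs , complete) = _ , record
  { to        = to
  ; from      = List.lookup ys
  ; to-cong   = λ {x} {y} x≈y → injective _ _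
                  (S.trans (S.sym (here≈ x)) (S.trans x≈y (here≈ y)))
  ; from-cong = λ { refl → S.refl }
  ; inverse   = (λ {i} {x} x≈yᵢ → injective _ _ (S.trans (S.sym (here≈ x)) x≈yᵢ))
              , (λ { {x} refl → S.sym (here≈ x) })
  }
  where
  module S = Setoid S
  S? : DecSetoid 0ℓ 0ℓ
  S? = record { isDecEquivalence = record { isEquivalence = S.isEquivalence ; _≟_ = _≈?_ } }
  ys : List S.Carrier
  ys = deduplicate _≈?_ xs
  injective : ∀ i j → List.lookup ys i S.≈ List.lookup ys j → i ≡ j
  injective = lookup-injective S (deduplicate-! S? xs)
  ∈ys : IsEnumeration S ys
  ∈ys = deduplicate⁺ S? complete
  to : S.Carrier → Fin _
  to x = index (∈ys x)
  here≈ : ∀ x → x S.≈ List.lookup ys (to x)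
  here≈ x = lookup-index (∈ys x)

-- The covering condition ranges over all proofs `p` because the list contains `f a p` for whichever
-- proof the decision procedure returns.
filterMap-enumeration : ∀ {A : Set} {P : A → Set} (S : Setoid 0ℓ 0ℓ) → (∀ a → Dec (P a)) →
  (f : ∀ a → P a → Setoid.Carrier S) (xs : List A) →
  (∀ s → Any (λ a → P a × (∀ p → Setoid._≈_ S s (f a p))) xs) → ∃ (IsEnumeration S)
filterMap-enumeration {A} {P} S P? f xs complete =
  concatMap images xs , λ s → concatMap⁺ images (Any.map covers (complete s))
  where
  open Setoid S using (_≈_; Carrier)
  images : A → List Carrier
  images a with P? a
  ... | yes p = [ f a p ]
  ... | no  _ = []
  covers : ∀ {s a} → P a × (∀ p → s ≈ f a p) → Any (s ≈_) (images a)
  covers {a = a} (p , s≈) with P? a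
  ... | yes p′ = here (s≈ p′)
  ... | no ¬p  = contradiction p ¬p

-- Cost one from a single rigid object.

module _ {G : Graph} (X : Colorable G) where
  open Colorable X
  private module X = Setoid objects

  constant⇒¬distinguishing : ∀ (ρ : Automorphism G) → ¬ IsIdentity ρ →
    ∀ {d} (c : Coloring X d) → (∀ x y → Func.to c x ≡ Func.to c y) → ¬ IsDistinguishing X c
  constant⇒¬distinguishing ρ ρ≢id c constant dist = ρ≢id (dist ρ (λ x → constant _ _))

  -- Giving `x₀` a color of its own forces every color-preserving automorphism to fix `x₀`, hence to
  -- be the identity. The object `y₀` makes the other class nonempty, so the smaller class has size
  -- 1. The nontrivial `ρ` preserves every constant coloring, which excludes both fewer than two
  -- colors and an empty class.
  cost-one : Decidable X._≈_ → ∃ (IsEnumeration objects) →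
    ∀ x₀ y₀ → ¬ (y₀ X.≈ x₀) →
    (∀ φ → act φ x₀ X.≈ x₀ → IsIdentity φ) →
    (ρ : Automorphism G) → ¬ IsIdentity ρ →
    IsCost X 1
  cost-one _≈?_ (xs , complete) x₀ y₀ y₀≉x₀ rigid ρ ρ≢id =
      ((singleOut , singleOut-distinguishing) , λ _ (c , dist) → 2≤colors c dist)
    , (singleOut , singleOut-distinguishing , 1 , _ , class₀ , proj₂ class₁ , sym (m≤n⇒m⊓n≡m 1≤class₁))
    , λ _ (c , dist , a , b , A , B , m≡) → subst (1 ≤_) (sym m≡) (1≤smaller c dist A B)
    where
    color : X.Carrier → Fin 2
    color x with x ≈? x₀
    ... | yes _ = zero
    ... | no  _ = suc zero

    color-cong : ∀ {x y} → x X.≈ y → color x ≡ color y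
    color-cong {x} {y} x≈y with x ≈? x₀ | y ≈? x₀
    ... | yes _   | yes _   = refl
    ... | yes x≈  | no  y≉  = contradiction (X.trans (X.sym x≈y) x≈) y≉
    ... | no  x≉  | yes y≈  = contradiction (X.trans x≈y y≈) x≉
    ... | no  _   | no  _   = refl

    color-zero⁻ : ∀ {x} → color x ≡ zero → x X.≈ x₀
    color-zero⁻ {x} eq with x ≈? x₀ | eq
    ... | yes x≈ | _  = x≈
    ... | no  _  | ()

    color-zero⁺ : color x₀ ≡ zero
    color-zero⁺ with x₀ ≈? x₀
    ... | yes _  = refl
    ... | no x≉x = contradiction X.refl x≉x

    color-one⁺ : color y₀ ≡ suc zero
    color-one⁺ with y₀ ≈? x₀
    ... | yes y₀≈x₀ = contradiction y₀≈x₀ y₀≉x₀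
    ... | no  _     = refl

    singleOut : Coloring X 2
    singleOut = record { to = color ; cong = color-cong }

    singleOut-distinguishing : IsDistinguishing X singleOut
    singleOut-distinguishing φ preserved =
      rigid φ (color-zero⁻ (trans (preserved x₀) color-zero⁺))

    class₀ : HasSize (colorClass X singleOut zero) 1
    class₀ = record
      { to        = λ _ → zero
      ; from      = λ _ → x₀ , color-zero⁺
      ; to-cong   = λ _ → refl
      ; from-cong = λ _ → X.refl
      ; inverse   = (λ { {zero} _ → refl }) , (λ { {_ , eq} _ → X.sym (color-zero⁻ eq) })
      }

    class₁ : ∃ (HasSize (colorClass X singleOut (suc zero)))
    class₁ = enumeration⇒hasSize (colorClass X singleOut (suc zero)) (λ (x , _) (y , _) → x ≈? y)
      (filterMap-enumeration (colorClass X singleOut (suc zero)) (λ x → color x Fin.≟ suc zero) _,_ xs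
        λ (x , eq) → Any.map (λ x≈y → trans (sym (color-cong x≈y)) eq , λ _ → x≈y) (complete x))

    1≤class₁ : 1 ≤ proj₁ class₁
    1≤class₁ with proj₁ class₁ | Inverse.to (proj₂ class₁) (y₀ , color-one⁺)
    ... | suc _ | _ = s≤s z≤n

    2≤colors : ∀ {d} (c : Coloring X d) → IsDistinguishing X c → 2 ≤ d
    2≤colors {zero} c _ with () ← Func.to c x₀
    2≤colors {suc zero} c dist =
      contradiction dist (constant⇒¬distinguishing ρ ρ≢id c (λ x y → unique (Func.to c x) (Func.to c y)))
      where
      unique : ∀ (i j : Fin 1) → i ≡ j
      unique zero zero = refl
    2≤colors {suc (suc _)} _ _ = s≤s (s≤s z≤n)

    avoids : ∀ (c : Coloring X 2) {i} → HasSize (colorClass X c i) 0 → ∀ x → Func.to c x ≢ i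
    avoids c empty x eq with () ← Inverse.to empty (x , eq)

    other₀ : ∀ {i : Fin 2} → i ≢ zero → i ≡ suc zero
    other₀ {zero}     i≢0 = contradiction refl i≢0
    other₀ {suc zero} _   = refl

    other₁ : ∀ {i : Fin 2} → i ≢ suc zero → i ≡ zero
    other₁ {zero}     _   = refl
    other₁ {suc zero} i≢1 = contradiction refl i≢1

    1≤smaller : ∀ (c : Coloring X 2) → IsDistinguishing X c → ∀ {a b} →
      HasSize (colorClass X c zero) a → HasSize (colorClass X c (suc zero)) b → 1 ≤ a ⊓ b
    -- With only two colors, an empty class makes the coloring constant.
    1≤smaller c dist {zero} A _ = contradiction dist (constant⇒¬distinguishing ρ ρ≢id c
      λ x y → trans (other₀ (avoids c A x)) (sym (other₀ (avoids c A y))))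
    1≤smaller c dist {suc _} {zero} _ B = contradiction dist (constant⇒¬distinguishing ρ ρ≢id c
      λ x y → trans (other₁ (avoids c B x)) (sym (other₁ (avoids c B y))))
    1≤smaller c dist {suc _} {suc _} _ _ = s≤s z≤n

-- Inverses and reflections.

invert : ∀ {G} → Automorphism G → Automorphism G
invert {G} φ = record
  { bijection   = ↔-sym φ.bijection
  ; preserves-~ = mk⇔
      (λ u~v → Equivalence.from φ.preserves-~ (subst₂ _~_ (sym (to∘from _)) (sym (to∘from _)) u~v))
      (λ fu~fv → subst₂ _~_ (to∘from _) (to∘from _) (Equivalence.to φ.preserves-~ fu~fv))
  }
  where
  module φ = Automorphism φ
  open Graph G using (_~_)
  to∘from = Inverse.strictlyInverseˡ φ.bijection

involution : ∀ {G} (f : Vertex G → Vertex G) → (∀ v → f (f v) ≡ v) →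
  (∀ {u v} → Graph._~_ G u v → Graph._~_ G (f u) (f v)) → Automorphism G
involution {G} f f∘f f-~ = record
  { bijection   = mk↔ₛ′ f f f∘f f∘f
  ; preserves-~ = mk⇔ f-~ (λ fu~fv → subst₂ (Graph._~_ G) (f∘f _) (f∘f _) (f-~ fu~fv))
  }

opposite-~ : ∀ {n} {i j : Fin n} → suc (toℕ i) ≡ toℕ j → suc (toℕ (opposite j)) ≡ toℕ (opposite i)
opposite-~ {n} {i} {j} eq = trans (cong suc (trans (opposite-prop j) (cong (λ m → n ∸ suc m) (sym eq))))
  -- The truncated subtraction is exact because `suc (toℕ i)`, being `toℕ j`, is still below `n`.
  (trans (sym (+-∸-assoc 1 (subst (λ m → suc m ≤ n) (sym eq) (toℕ<n j)))) (sym (opposite-prop i)))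

path-reflection-~ : ∀ {n} {i j : Fin n} → Graph._~_ (path n) i j → Graph._~_ (path n) (opposite i) (opposite j)
path-reflection-~ (inj₁ eq) = inj₂ (opposite-~ eq)
path-reflection-~ (inj₂ eq) = inj₁ (opposite-~ eq)

reflection : ∀ {k} (ns : Vec ℕ (suc k)) → Automorphism (pathProduct ns)
reflection (n ∷ [])     = involution opposite opposite-involutive path-reflection-~
reflection (n ∷ m ∷ ns) = involution
  (λ (x , v) → opposite x , v)
  (λ (x , v) → cong (_, v) (opposite-involutive x))
  λ { (inj₁ (x≡y , u~v)) → inj₁ (cong opposite x≡y , u~v)
    ; (inj₂ (x~y , u≡v)) → inj₂ (path-reflection-~ x~y , u≡v) }

-- Coordinates, decidability and enumeration for products of paths.

coord : ∀ {k} (ns : Vec ℕ (suc k)) → Vertex (pathProduct ns) → ∀ i → Fin (lookup ns i)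
coord (n ∷ [])     x       zero    = x
coord (n ∷ m ∷ ns) (x , v) zero    = x
coord (n ∷ m ∷ ns) (x , v) (suc i) = coord (m ∷ ns) v i

fromCoords : ∀ {k} (ns : Vec ℕ (suc k)) → (∀ i → Fin (lookup ns i)) → Vertex (pathProduct ns)
fromCoords (n ∷ [])     f = f zero
fromCoords (n ∷ m ∷ ns) f = f zero , fromCoords (m ∷ ns) (f ∘ suc)

coord-fromCoords : ∀ {k} (ns : Vec ℕ (suc k)) f i → coord ns (fromCoords ns f) i ≡ f i
coord-fromCoords (n ∷ [])     f zero    = refl
coord-fromCoords (n ∷ m ∷ ns) f zero    = refl
coord-fromCoords (n ∷ m ∷ ns) f (suc i) = coord-fromCoords (m ∷ ns) (f ∘ suc) i

coord-injective : ∀ {k} (ns : Vec ℕ (suc k)) {u v} → (∀ i → coord ns u i ≡ coord ns v i) → u ≡ v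
coord-injective (n ∷ [])     eq = eq zero
coord-injective (n ∷ m ∷ ns) eq = cong₂ _,_ (eq zero) (coord-injective (m ∷ ns) (eq ∘ suc))

vertex-≟ : ∀ {k} (ns : Vec ℕ (suc k)) → DecidableEquality (Vertex (pathProduct ns))
vertex-≟ (n ∷ [])     = Fin._≟_
vertex-≟ (n ∷ m ∷ ns) = ≡-dec Fin._≟_ (vertex-≟ (m ∷ ns))

vertex-enumeration : ∀ {k} (ns : Vec ℕ (suc k)) → ∃ (IsEnumeration (setoid (Vertex (pathProduct ns))))
vertex-enumeration (n ∷ [])     = allFin n , ∈-allFin
vertex-enumeration (n ∷ m ∷ ns) = let vs , complete = vertex-enumeration (m ∷ ns) in
  cartesianProduct (allFin n) vs , λ (x , v) → ∈-cartesianProduct⁺ (∈-allFin x) (complete v)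

~-dec : ∀ {k} (ns : Vec ℕ (suc k)) → Decidable (Graph._~_ (pathProduct ns))
~-dec (n ∷ [])     x y = (suc (toℕ x) ≟ toℕ y) ⊎-dec (suc (toℕ y) ≟ toℕ x)
~-dec (n ∷ m ∷ ns) (x , u) (y , v) =
  ((x Fin.≟ y) ×-dec ~-dec (m ∷ ns) u v) ⊎-dec (~-dec (n ∷ []) x y ×-dec vertex-≟ (m ∷ ns) u v)

edge-≟ : ∀ {k} (ns : Vec ℕ (suc k)) → Decidable (Setoid._≈_ (edgeSetoid (pathProduct ns)))
edge-≟ ns (u , v , _) (u′ , v′ , _) =
  ((u ≟ᵥ u′) ×-dec (v ≟ᵥ v′)) ⊎-dec ((u ≟ᵥ v′) ×-dec (v ≟ᵥ u′))
  where _≟ᵥ_ = vertex-≟ ns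

-- Filtering ordered pairs lists each edge in both orientations; the repetition is harmless, since
-- counting removes duplicates up to the edge equality.
edge-enumeration : ∀ {k} (ns : Vec ℕ (suc k)) → ∃ (IsEnumeration (edgeSetoid (pathProduct ns)))
edge-enumeration ns =
  let vs , complete = vertex-enumeration ns in
  filterMap-enumeration (edgeSetoid (pathProduct ns)) (λ (u , v) → ~-dec ns u v)
    (λ (u , v) u~v → u , v , u~v) (cartesianProduct vs vs)
    λ (u , v , u~v) → Any.map (λ { refl → u~v , λ _ → inj₁ (refl , refl) })
      (∈-cartesianProduct⁺ (complete u) (complete v))

-- The covering relation of the box.

CoversAlong : ∀ {V : Set} {N} → (V → Fin N → ℕ) → V → Fin N → V → Set
CoversAlong c u i v = suc (c u i) ≡ c v i × (∀ j → j ≢ i → c u j ≡ c v j)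

-- This interface frees the symmetry argument from recursion on the nested product. Coordinates are
-- natural numbers rather than `Fin` elements so that positions on axes of different lengths can be
-- compared. Of `level`, the coordinate sum in the instance below, only its growth by one along
-- covers is retained.
record BoxCoordinates (G : Graph) {N : ℕ} (n : Fin N → ℕ) : Set where
  open Graph G using (_~_)
  field
    c            : Vertex G → Fin N → ℕ
    c-bounded    : ∀ v i → c v i < n i
    c-ext        : ∀ {u v} → (∀ i → c u i ≡ c v i) → u ≡ v
    c-surjective : ∀ (f : Fin N → ℕ) → (∀ i → f i < n i) → ∃ λ v → ∀ i → c v i ≡ f i
    covers⇒~     : ∀ {u v i} → CoversAlong c u i v → u ~ v
    ~⇒covers     : ∀ {u v} → u ~ v → ∃ λ i → CoversAlong c u i v ⊎ CoversAlong c v i u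
    level        : Vertex G → ℕ
    level-covers : ∀ {u v i} → CoversAlong c u i v → level v ≡ suc (level u)

Covers : ∀ {k} (ns : Vec ℕ (suc k)) → Vertex (pathProduct ns) → Fin (suc k) → Vertex (pathProduct ns) → Set
Covers ns = CoversAlong (λ v i → toℕ (coord ns v i))

product-covers⇒~ : ∀ {k} (ns : Vec ℕ (suc k)) {u v i} → Covers ns u i v → Graph._~_ (pathProduct ns) u v
product-covers⇒~ (n ∷ [])     {i = zero} (up , _) = inj₁ up
product-covers⇒~ (n ∷ m ∷ ns) {i = zero} (up , rest) =
  inj₂ (inj₁ up , coord-injective (m ∷ ns) (λ j → toℕ-injective (rest (suc j) λ ())))
product-covers⇒~ (n ∷ m ∷ ns) {i = suc i} (up , rest) =
  inj₁ (toℕ-injective (rest zero λ ())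
      , product-covers⇒~ (m ∷ ns) (up , λ j j≢i → rest (suc j) (j≢i ∘ Fin.suc-injective)))

product-~⇒covers : ∀ {k} (ns : Vec ℕ (suc k)) {u v} → Graph._~_ (pathProduct ns) u v →
  ∃ λ i → Covers ns u i v ⊎ Covers ns v i u
product-~⇒covers (n ∷ []) x~y = zero , Sum.map along along x~y
  where
  along : ∀ {x y} → suc (toℕ x) ≡ toℕ y → Covers (n ∷ []) x zero y
  along up = up , λ { zero j≢0 → contradiction refl j≢0 }
product-~⇒covers (n ∷ m ∷ ns) (inj₁ (refl , u~v)) =
  let i , c = product-~⇒covers (m ∷ ns) u~v in suc i , Sum.map lift lift c
  where
  lift : ∀ {x u i v} → Covers (m ∷ ns) u i v → Covers (n ∷ m ∷ ns) (x , u) (suc i) (x , v)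
  lift (up , rest) = up , λ { zero _ → refl ; (suc j) j≢i → rest j (j≢i ∘ cong suc) }
product-~⇒covers (n ∷ m ∷ ns) (inj₂ (x~y , refl)) = zero , Sum.map along along x~y
  where
  along : ∀ {x y u} → suc (toℕ x) ≡ toℕ y → Covers (n ∷ m ∷ ns) (x , u) zero (y , u)
  along up = up , λ { zero j≢0 → contradiction refl j≢0 ; (suc _) _ → refl }

product-level : ∀ {k} (ns : Vec ℕ (suc k)) → Vertex (pathProduct ns) → ℕ
product-level (n ∷ [])     x       = toℕ x
product-level (n ∷ m ∷ ns) (x , v) = toℕ x + product-level (m ∷ ns) v

product-level-covers : ∀ {k} (ns : Vec ℕ (suc k)) {u v i} → Covers ns u i v →
  product-level ns v ≡ suc (product-level ns u)
product-level-covers (n ∷ [])     {i = zero} (up , _) = sym up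
product-level-covers (n ∷ m ∷ ns) {i = zero} (up , rest) =
  sym (cong₂ _+_ up (cong (product-level (m ∷ ns))
    (coord-injective (m ∷ ns) (λ j → toℕ-injective (rest (suc j) λ ())))))
product-level-covers (n ∷ m ∷ ns) {x , u} {y , v} {i = suc i} (up , rest) =
  trans (cong₂ _+_ (sym (rest zero λ ()))
                   (product-level-covers (m ∷ ns) {u} {v} (up , λ j j≢i → rest (suc j) (j≢i ∘ Fin.suc-injective))))
        (+-suc (toℕ x) _)

boxCoordinates : ∀ {k} (ns : Vec ℕ (suc k)) → BoxCoordinates (pathProduct ns) (lookup ns)
boxCoordinates ns = record
  { c            = λ v i → toℕ (coord ns v i)
  ; c-bounded    = λ v i → toℕ<n (coord ns v i)
  ; c-ext        = λ eq → coord-injective ns (toℕ-injective ∘ eq)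
  ; c-surjective = λ f f< → fromCoords ns (λ i → fromℕ< (f< i)) ,
                     λ i → trans (cong toℕ (coord-fromCoords ns _ i)) (toℕ-fromℕ< (f< i))
  ; covers⇒~     = product-covers⇒~ ns
  ; ~⇒covers     = product-~⇒covers ns
  ; level        = product-level ns
  ; level-covers = product-level-covers ns
  }

-- Elementary properties of covers and the origin.

module _ {G : Graph} {N : ℕ} {n : Fin N → ℕ} (B : BoxCoordinates G n) (3≤n : ∀ i → 3 ≤ n i) where

  open Graph G using (_~_)
  open BoxCoordinates B

  private
    _⋖[_]_ : Vertex G → Fin N → Vertex G → Set
    _⋖[_]_ = CoversAlong c

    c-ext-at : ∀ {u v} i → c u i ≡ c v i → (∀ j → j ≢ i → c u j ≡ c v j) → u ≡ v
    c-ext-at {u} {v} i at-i off-i = c-ext agree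
      where
      agree : ∀ j → c u j ≡ c v j
      agree j with j Fin.≟ i
      ... | yes refl = at-i
      ... | no  j≢i  = off-i j j≢i

  origin : Vertex G
  origin = proj₁ (c-surjective (const 0) (λ i → ≤-trans (s≤s z≤n) (3≤n i)))

  origin-coord : ∀ i → c origin i ≡ 0
  origin-coord = proj₂ (c-surjective _ _)

  replaceCoord : ∀ v i {x} → x < n i → ∃ λ w → c w i ≡ x × (∀ j → j ≢ i → c w j ≡ c v j)
  replaceCoord v i {x} x<nᵢ = let w , w-coord = c-surjective f f< in w ,
    trans (w-coord i) (updateAt-updates i (c v)) ,
    λ j j≢i → trans (w-coord j) (updateAt-minimal j i (c v) j≢i)
    where
    f : Fin N → ℕ
    f = updateAt (c v) i (const x)
    f< : ∀ j → f j < n j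
    f< j with j Fin.≟ i
    ... | yes refl = subst (_< n j) (sym (updateAt-updates i (c v))) x<nᵢ
    ... | no  j≢i  = subst (_< n j) (sym (updateAt-minimal j i (c v) j≢i)) (c-bounded v j)

  cover-above : ∀ v i → suc (c v i) < n i → ∃ λ w → v ⋖[ i ] w
  cover-above v i lt = let w , at-i , off-i = replaceCoord v i lt in
    w , sym at-i , λ j j≢i → sym (off-i j j≢i)

  cover-below : ∀ v i {t} → c v i ≡ suc t → ∃ λ u → u ⋖[ i ] v
  cover-below v i {t} eq =
    let u , at-i , off-i = replaceCoord v i (<-trans (n<1+n t) (subst (_< n i) eq (c-bounded v i)))
    in  u , trans (cong suc at-i) (sym eq) , off-i

  ⋖-functional : ∀ {u v w i} → u ⋖[ i ] v → u ⋖[ i ] w → v ≡ w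
  ⋖-functional {i = i} (up , rest) (up′ , rest′) =
    c-ext-at i (trans (sym up) up′) (λ j j≢i → trans (sym (rest j j≢i)) (rest′ j j≢i))

  ⋖-injective : ∀ {u v w i} → u ⋖[ i ] w → v ⋖[ i ] w → u ≡ v
  ⋖-injective {i = i} (up , rest) (up′ , rest′) =
    c-ext-at i (suc-injective (trans up (sym up′))) (λ j j≢i → trans (rest j j≢i) (sym (rest′ j j≢i)))

  -- A cover changes one coordinate only, so any coordinate seen to change reveals its direction.
  ⋖-direction : ∀ {u v i j} → u ⋖[ i ] v → c u j ≢ c v j → i ≡ j
  ⋖-direction {i = i} {j} (_ , rest) c≢ with i Fin.≟ j
  ... | yes i≡j = i≡j
  ... | no  i≢j = contradiction (rest j (i≢j ∘ sym)) c≢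

  ⋖-monotone : ∀ {u v i} → u ⋖[ i ] v → ∀ j → c u j ≤ c v j
  ⋖-monotone {i = i} (up , rest) j with j Fin.≟ i
  ... | yes refl = <⇒≤ (≤-reflexive up)
  ... | no  j≢i  = ≤-reflexive (rest j j≢i)

  origin-minimal : ∀ {u i} → ¬ u ⋖[ i ] origin
  origin-minimal {i = i} (up , _) with () ← trans up (origin-coord i)

  origin-or-above : ∀ v → v ≡ origin ⊎ (∃₂ λ i t → c v i ≡ suc t)
  origin-or-above v with any? (λ i → ¬? (c v i ≟ 0))
  ... | no all-zero = inj₁ (c-ext λ i →
          trans (decidable-stable (c v i ≟ 0) (λ c≢0 → all-zero (i , c≢0))) (sym (origin-coord i)))
  ... | yes (i , c≢0) with c v i in eq
  ...   | zero  = contradiction refl c≢0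
  ...   | suc t = inj₂ (i , t , eq)

  -- Automorphisms fixing the origin preserve levels and covers.

  module FixesOrigin (φ : Automorphism G) (φ-origin : Automorphism.to φ origin ≡ origin) where
    open Automorphism φ

    to-~ : ∀ {u v} → u ~ v → to u ~ to v
    to-~ = Equivalence.to preserves-~

    -- Induction along a descending chain to the origin: `v` has a lower cover `u`, and the image of
    -- `v`, being adjacent to that of `u`, lies at most one level above it.
    level-nonincreasing : ∀ m v → level v ≡ m → level (to v) ≤ m
    level-nonincreasing m v eq with origin-or-above v
    ... | inj₁ refl = ≤-reflexive (trans (cong level φ-origin) eq)
    ... | inj₂ (i , t , cvi) with u , u⋖v ← cover-below v i cvi
                             -- A vertex with a lower cover has positive level, so `m` must be a
                             -- successor.
                             with m | trans (sym (level-covers u⋖v)) eq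
    ...   | suc m′ | level-u
      with IH ← level-nonincreasing m′ u (suc-injective level-u)
      with ~⇒covers (to-~ (covers⇒~ u⋖v))
    ...   | _ , inj₁ φu⋖φv = subst (_≤ suc m′) (sym (level-covers φu⋖φv)) (s≤s IH)
    ...   | _ , inj₂ φv⋖φu =
            ≤-trans (n≤1+n _) (≤-trans (subst (_≤ m′) (level-covers φv⋖φu) IH) (n≤1+n m′))

  module _ (φ : Automorphism G) (φ-origin : Automorphism.to φ origin ≡ origin) where
    open Automorphism φ
    open Inverse bijection using (from; strictlyInverseˡ; strictlyInverseʳ)

    invert-origin : Automorphism.to (invert φ) origin ≡ origin
    invert-origin = trans (cong from (sym φ-origin)) (strictlyInverseʳ origin)

    level-preserved : ∀ v → level (to v) ≡ level v
    -- The bound for `φ` gives one inequality; the bound for its inverse, taken at `to v`, gives the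
    -- other.
    level-preserved v = ≤-antisym
      (FixesOrigin.level-nonincreasing φ φ-origin _ v refl)
      (subst (λ w → level w ≤ level (to v)) (strictlyInverseʳ v)
        (FixesOrigin.level-nonincreasing (invert φ) invert-origin _ (to v) refl))

    -- Adjacent images form a cover one way or the other; the reversed one would make `level u`
    -- equal to itself plus two. The direction `j` may still differ from `i`.
    ⋖-preserved : ∀ {u v i} → u ⋖[ i ] v → ∃ λ j → to u ⋖[ j ] to v
    ⋖-preserved {u} {v} u⋖v with ~⇒covers (Equivalence.to preserves-~ (covers⇒~ u⋖v))
    ... | j , inj₁ φu⋖φv = j , φu⋖φv
    ... | _ , inj₂ φv⋖φu = contradiction
      (trans (sym (level-preserved u)) (trans (level-covers φv⋖φu)
        (cong suc (trans (level-preserved v) (level-covers u⋖v)))))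
      (<⇒≢ (m<n⇒m<1+n (n<1+n (level u))))

  -- Images of axes.

  OnAxis : Fin N → ℕ → Vertex G → Set
  OnAxis i t v = c v i ≡ t × (∀ j → j ≢ i → c v j ≡ 0)

  axis-cover-direction : ∀ {u v i m t} → OnAxis i t v → u ⋖[ m ] v → m ≡ i
  axis-cover-direction {i = i} {m} (_ , off-i) (up , _) with m Fin.≟ i
  ... | yes m≡i = m≡i
  ... | no  m≢i with () ← trans up (off-i m m≢i)

  -- The inverse of `φ` carries `w` to a lower cover of `v`; on an axis that can only be `u`.
  axis-image-lower-cover : (φ : Automorphism G) → Automorphism.to φ origin ≡ origin →
    ∀ {u v w i j t} → OnAxis i t v → u ⋖[ i ] v → w ⋖[ j ] Automorphism.to φ v → w ≡ Automorphism.to φ u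
  axis-image-lower-cover φ φ-origin {u} {v} {w} axis u⋖v w⋖φv
    with m , w′⋖v ← ⋖-preserved (invert φ) (invert-origin φ φ-origin) w⋖φv
    rewrite Inverse.strictlyInverseʳ (Automorphism.bijection φ) v
    with refl ← axis-cover-direction axis w′⋖v
    = trans (sym (Inverse.strictlyInverseˡ (Automorphism.bijection φ) w))
            (cong (Automorphism.to φ) (⋖-injective w′⋖v u⋖v))

  -- A vertex on an axis has only one lower cover, whereas turning off the axis
  -- would create a second one.
  axis-image : (φ : Automorphism G) → Automorphism.to φ origin ≡ origin →
    ∀ {i j e} → origin ⋖[ i ] e → origin ⋖[ j ] Automorphism.to φ e →
    ∀ t {v} → OnAxis i (suc t) v → OnAxis j (suc t) (Automorphism.to φ v)
  axis-image φ φ-origin {i} {j} o⋖e (o⋖φe , rest) zero (at-i , off-i)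
    with refl ← ⋖-functional o⋖e (trans (cong suc (origin-coord i)) (sym at-i)
                                 , λ l l≢i → trans (origin-coord l) (sym (off-i l l≢i)))
    = trans (sym o⋖φe) (cong suc (origin-coord j)) , λ l l≢j → trans (sym (rest l l≢j)) (origin-coord l)
  axis-image φ φ-origin {i} {j} o⋖e o⋖φe (suc t) {v} (at-i , off-i)
    with u , u⋖v@(u-i , u-off) ← cover-below v i at-i
    with φu-j , φu-off ← axis-image φ φ-origin o⋖e o⋖φe t {u}
           (suc-injective (trans u-i at-i) , λ l l≢i → trans (u-off l l≢i) (off-i l l≢i))
    with l , (φu-l , φu⋖φv-off) ← ⋖-preserved φ φ-origin u⋖v
    with l Fin.≟ j
  ... | yes refl = trans (sym φu-l) (cong suc φu-j) ,
                   λ m m≢j → trans (sym (φu⋖φv-off m m≢j)) (φu-off m m≢j)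
  ... | no l≢j
    -- A step in direction `l` leaves coordinate `j` at `suc t`. Being positive, it admits a lower
    -- cover `w` along `j`; identifying `w` with the image of `u` would give that image two
    -- different `j`-coordinates.
    with φv-j ← trans (sym (φu⋖φv-off j (l≢j ∘ sym))) φu-j
    with w , w⋖φv ← cover-below _ j φv-j
    with refl ← axis-image-lower-cover φ φ-origin (at-i , off-i) u⋖v w⋖φv
    = contradiction (trans (proj₁ w⋖φv) (trans φv-j (sym φu-j))) 1+n≢n

  -- The far end of axis `i` is sent to axis `j` at the same distance from the origin, so axis `j`
  -- must be long enough to contain it.
  axis-length : (φ : Automorphism G) → Automorphism.to φ origin ≡ origin →
    ∀ {i j e} → origin ⋖[ i ] e → origin ⋖[ j ] Automorphism.to φ e → n i ≤ n j
  axis-length φ φ-origin {i} {j} o⋖e o⋖φe =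
    -- With `n i` written as `3 + t`, the far end has coordinate `2 + t`, the successor form that
    -- `axis-image` expects.
    let t , 3+t≡nᵢ = m≤n⇒∃[o]m+o≡n (3≤n i)
        v , at-i , off-i = replaceCoord origin i (≤-reflexive 3+t≡nᵢ)
        φv-j , _ = axis-image φ φ-origin o⋖e o⋖φe (suc t) (at-i , λ l l≢i → trans (off-i l l≢i) (origin-coord l))
    in  subst₂ _≤_ 3+t≡nᵢ refl (subst (_< n j) φv-j (c-bounded _ j))

  -- Rigidity at the origin.

  module _ (distinct : ∀ i j → i ≢ j → n i ≢ n j)
           (φ : Automorphism G) (φ-origin : Automorphism.to φ origin ≡ origin) where
    open Automorphism φ
    open Inverse bijection using (strictlyInverseʳ)

    -- The length bound for `φ` and for its inverse gives `n i ≡ n j`; distinctness of the lengths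
    -- enters here.
    axis-direction-fixed : ∀ {i j e} → origin ⋖[ i ] e → origin ⋖[ j ] to e → i ≡ j
    axis-direction-fixed {i} {j} {e} o⋖e o⋖φe = decidable-stable (i Fin.≟ j) λ i≢j →
      distinct i j i≢j (≤-antisym
        (axis-length φ φ-origin o⋖e o⋖φe)
        (axis-length (invert φ) (invert-origin φ φ-origin) o⋖φe
          (subst (origin ⋖[ i ]_) (sym (strictlyInverseʳ e)) o⋖e)))

    axis-fixed : ∀ {i t v} → OnAxis i (suc t) v → to v ≡ v
    axis-fixed {i} {t} {v} axis@(at-i , off-i) =
      -- The first vertex `e` on the axis determines the direction `j` in which the whole axis is
      -- sent.
      let e , o⋖e = cover-above origin i (subst (λ x → suc x < n i) (sym (origin-coord i))
                                                (≤-trans (s≤s (s≤s z≤n)) (3≤n i)))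
          j , φo⋖φe = ⋖-preserved φ φ-origin o⋖e
          o⋖φe = subst (_⋖[ j ] to e) φ-origin φo⋖φe
          φv-i , φv-off = subst (λ l → OnAxis l (suc t) (to v)) (sym (axis-direction-fixed o⋖e o⋖φe))
                                (axis-image φ φ-origin o⋖e o⋖φe t axis)
      in  c-ext-at i (trans φv-i (sym at-i)) (λ l l≢i → trans (φv-off l l≢i) (sym (off-i l l≢i)))

    -- The image of `v` covers both `u` and `w`. Since `w` exceeds `u` in coordinate `i`, so does
    -- that image; hence it covers `u` in direction `i`, as `v` does.
    fixed-from-two-covers : ∀ {u v w i j} → i ≢ j → u ⋖[ i ] v → w ⋖[ j ] v →
      to u ≡ u → to w ≡ w → to v ≡ v
    fixed-from-two-covers {u} {v} {w} {i} {j} i≢j u⋖v w⋖v φu≡u φw≡w =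
      let a , φu⋖φv = ⋖-preserved φ φ-origin u⋖v
          b , φw⋖φv = ⋖-preserved φ φ-origin w⋖v
          u⋖φv = subst (_⋖[ a ] to v) φu≡u φu⋖φv
          w⋖φv = subst (_⋖[ b ] to v) φw≡w φw⋖φv
          a≡i  = ⋖-direction u⋖φv (<⇒≢ (≤-trans (≤-reflexive (trans (proj₁ u⋖v) (sym (proj₂ w⋖v i i≢j))))
                                               (⋖-monotone w⋖φv i)))
      in  ⋖-functional (subst (λ l → u ⋖[ l ] to v) a≡i u⋖φv) u⋖v

    -- Strong induction on the level, with `m` as the structurally decreasing bound. The cases are
    -- the origin, a single nonzero coordinate, and two nonzero coordinates, which supply two lower
    -- covers.
    fixed-below-level : ∀ m v → level v < m → to v ≡ v
    fixed-below-level (suc m) v (s≤s level≤m) with origin-or-above v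
    ... | inj₁ refl = φ-origin
    ... | inj₂ (i , _ , v-i) with any? (λ j → ¬? (j Fin.≟ i) ×-dec ¬? (c v j ≟ 0))
    ...   | no off-i = axis-fixed (v-i , λ j j≢i → decidable-stable (c v j ≟ 0) (λ c≢0 → off-i (j , j≢i , c≢0)))
    ...   | yes (j , j≢i , v-j≢0) =
      let u , u⋖v = cover-below v i v-i
          w , w⋖v = cover-below v j (sym (suc-pred (c v j) ⦃ ≢-nonZero v-j≢0 ⦄))
      in  fixed-from-two-covers (j≢i ∘ sym) u⋖v w⋖v
            (fixed-below-level m u (subst (_≤ m) (level-covers u⋖v) level≤m))
            (fixed-below-level m w (subst (_≤ m) (level-covers w⋖v) level≤m))

    origin-rigid : IsIdentity φ
    origin-rigid v = fixed-below-level _ v ≤-refl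

  -- The origin has at most one neighbour per direction, thus at most `N`. But `e` has at least
  -- `N + 1`: the origin and an upper cover in each direction. A swap would inject the latter into
  -- the former.
  not-swapped : ∀ {d e} → origin ⋖[ d ] e → (φ : Automorphism G) →
    Automorphism.to φ origin ≡ e → Automorphism.to φ e ≢ origin
  not-swapped {d} {e} o⋖e@(up , rest) φ φo≡e φe≡o =
    let x , y , x<y , same = pigeonhole (n<1+n N) (proj₁ ∘ image-direction)
    in  neighbour-distinct x y x<y (to-injective
          (⋖-functional (subst (λ i → origin ⋖[ i ] to (neighbour x)) same (proj₂ (image-direction x)))
                         (proj₂ (image-direction y))))
    where
    open Automorphism φ
    to-injective : ∀ {u v} → to u ≡ to v → u ≡ v
    to-injective eq = trans (sym (Inverse.strictlyInverseʳ bijection _))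
      (trans (cong (Inverse.from bijection) eq) (Inverse.strictlyInverseʳ bijection _))

    e≤1 : ∀ i → c e i ≤ 1
    e≤1 i with i Fin.≟ d
    ... | yes refl = ≤-reflexive (trans (sym up) (cong suc (origin-coord d)))
    ... | no  i≢d  = subst (_≤ 1) (trans (sym (origin-coord i)) (rest i i≢d)) z≤n

    above-e : ∀ i → ∃ λ w → e ⋖[ i ] w
    -- Coordinates of `e` are at most 1, so length at least 3 leaves room to go up in every
    -- direction, including `d`.
    above-e i = cover-above e i (≤-trans (s≤s (s≤s (e≤1 i))) (3≤n i))

    neighbour : Fin (suc N) → Vertex G
    neighbour zero    = origin
    neighbour (suc i) = proj₁ (above-e i)

    e~neighbour : ∀ x → e ~ neighbour x
    e~neighbour zero    = Graph.~-sym G (covers⇒~ o⋖e)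
    e~neighbour (suc i) = covers⇒~ (proj₂ (above-e i))

    neighbour-distinct : ∀ x y → toℕ x < toℕ y → neighbour x ≢ neighbour y
    -- An upper cover of `e` lies two levels above the origin.
    neighbour-distinct zero (suc j) _ eq = <⇒≢ (m<n⇒m<1+n (n<1+n (level origin)))
      (trans (cong level eq) (trans (level-covers (proj₂ (above-e j))) (cong suc (level-covers o⋖e))))
    -- Coordinate `i` is raised in the first upper cover but unchanged in the second.
    neighbour-distinct (suc i) (suc j) (s≤s i<j) eq =
      1+n≢n (trans (proj₁ (proj₂ (above-e i)))
        (trans (cong (λ v → c v i) eq) (sym (proj₂ (proj₂ (above-e j)) i (Fin.<⇒≢ i<j)))))

    image-direction : ∀ x → ∃ λ i → origin ⋖[ i ] to (neighbour x)
    image-direction x with ~⇒covers (subst (_~ to (neighbour x)) φe≡o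
                                           (Equivalence.to preserves-~ (e~neighbour x)))
    ... | i , inj₁ o⋖w = i , o⋖w
    ... | _ , inj₂ w⋖o = contradiction w⋖o origin-minimal

-- A moved vertex, and the colored corner vertex and edge.

reflection≢identity : ∀ {k} (ns : Vec ℕ (suc k)) → (∀ i → 3 ≤ lookup ns i) → ¬ IsIdentity (reflection ns)
reflection≢identity (suc (suc n) ∷ [])     3≤ns id with () ← id zero
reflection≢identity (suc zero ∷ [])        3≤ns id with s≤s () ← 3≤ns zero
reflection≢identity (zero ∷ [])            3≤ns id with () ← 3≤ns zero
reflection≢identity (suc (suc n) ∷ m ∷ ns) 3≤ns id
  -- Any vertex of the remaining factors would do; their origin is one at hand.
  with () ← id (zero , origin (boxCoordinates (m ∷ ns)) (3≤ns ∘ suc))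
reflection≢identity (suc zero ∷ m ∷ ns)    3≤ns id with s≤s () ← 3≤ns zero
reflection≢identity (zero ∷ m ∷ ns)        3≤ns id with () ← 3≤ns zero

theorem5p2 : ∀ (k : ℕ) (n : Vec ℕ (suc k)) →
    (∀ i j → i ≢ j → lookup n i ≢ lookup n j) →
    (∀ i → 3 ≤ lookup n i) →
    (pathProduct n HasEdgeDistinguishingCost 1) × (pathProduct n HasDistinguishingCost 1)
theorem5p2 k n distinct 3≤n =
    cost-one (edges G) (edge-≟ n) (edge-enumeration n)
      -- The first three vertices `o`, `e`, `f` of the first axis give the colored edge and a second
      -- edge for the other class.
      (o , e , covers⇒~ o⋖e) (e , f , covers⇒~ e⋖f) edges-differ edge-rigid ρ ρ≢id
  , cost-one (vertices G) (vertex-≟ n) (vertex-enumeration n)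
      o e e≢o (origin-rigid B 3≤n distinct) ρ ρ≢id
  where
  G = pathProduct n
  B = boxCoordinates n
  open BoxCoordinates B
  ρ = reflection n
  ρ≢id = reflection≢identity n 3≤n
  o = origin B 3≤n

  covering-e : ∃ λ e → CoversAlong c o zero e
  covering-e = cover-above B 3≤n o zero (subst (λ x → suc x < lookup n zero)
    (sym (origin-coord B 3≤n zero)) (≤-trans (s≤s (s≤s z≤n)) (3≤n zero)))
  e   = proj₁ covering-e
  o⋖e = proj₂ covering-e

  covering-f : ∃ λ f → CoversAlong c e zero f
  covering-f = cover-above B 3≤n e zero (subst (λ x → suc x < lookup n zero)
    (trans (cong suc (sym (origin-coord B 3≤n zero))) (proj₁ o⋖e)) (3≤n zero))
  f   = proj₁ covering-f
  e⋖f = proj₂ covering-f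

  e≢o : e ≢ o
  e≢o eq = 1+n≢n (trans (sym (level-covers o⋖e)) (cong level eq))

  f≢o : f ≢ o
  f≢o eq = <⇒≢ (m<n⇒m<1+n (n<1+n (level o)))
    (trans (cong level (sym eq)) (trans (level-covers e⋖f) (cong suc (level-covers o⋖e))))

  edges-differ : ¬ Setoid._≈_ (edgeSetoid G) (e , f , covers⇒~ e⋖f) (o , e , covers⇒~ o⋖e)
  edges-differ (inj₁ (e≡o , _)) = e≢o e≡o
  edges-differ (inj₂ (_ , f≡o)) = f≢o f≡o

  -- Fixing the unordered edge means fixing both ends or swapping them; the first case is rigidity
  -- at the corner, the second a neighbour count.
  edge-rigid : ∀ φ → Setoid._≈_ (edgeSetoid G) (Colorable.act (edges G) φ (o , e , covers⇒~ o⋖e))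
                                              (o , e , covers⇒~ o⋖e) → IsIdentity φ
  edge-rigid φ (inj₁ (φo≡o , _))    = origin-rigid B 3≤n distinct φ φo≡o
  edge-rigid φ (inj₂ (φo≡e , φe≡o)) = contradiction φe≡o (not-swapped B 3≤n o⋖e φ φo≡e)
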